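{- For every theory $\Gamma$ and every sentence $\varphi$ of $\mathcal{L}_3$: $\Gamma\models\varphi$ if and only if $\Gamma\vdash\varphi$.
   Context: Syntax of $\mathcal{L}_3$. Fix a set $P$ of nouns and a set $R$ of verbs. Terms: every noun $p\in P$ is a term; if $r\in R$ and $x$ is a term then $(r\ \mathsf{all}\ x)$ and $(r\ \mathsf{some}\ x)$ are terms. Sentences: $(\mathsf{all}\ x\ y)$ for terms $x,y$. A theory is a set of sentences. Semantics. A model $\mathcal{M}$ is a set $M$ (possibly empty) with $[\![p]\!]\subseteq M$ for $p\in P$ and $[\![r]\!]\subseteq M\times M$ for $r\in R$; $[\![r\ \mathsf{all}\ x]\!]=\{m\in M: m\,[\![r]\!]\,n\text{ for all }n\in[\![x]\!]\}$; $[\![r\ \mathsf{some}\ x]\!]=\{m\in M: m\,[\![r]\!]\,n\text{ for some }n\in[\![x]\!]\}$. $\mathcal{M}\models(\mathsf{all}\ x\ y)$ iff $[\![x]\!]\subseteq[\![y]\!]$. $\Gamma\models\varphi$ means every model of $\Gamma$ satisfies $\varphi$. Provability $\Gamma\vdash\varphi$ is defined by finite derivations using the following rules (for all terms $x,y,z$, verbs $r,s$ (possibly different), sentences $\varphi$), with non-withdrawn assumptions in $\Gamma$: infer $(\mathsf{all}\ x\ x)$ from no premises; from $(\mathsf{all}\ x\ y)$, $(\mathsf{all}\ y\ z)$ infer $(\mathsf{all}\ x\ z)$; from $(\mathsf{all}\ x\ y)$ infer $(\mathsf{all}\ (r\ \mathsf{all}\ y)\ (r\ \mathsf{all}\ x))$;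 from $(\mathsf{all}\ x\ y)$ infer $(\mathsf{all}\ (r\ \mathsf{some}\ x)\ (r\ \mathsf{some}\ y))$; from $(\mathsf{all}\ (r\ \mathsf{all}\ y)\ (r\ \mathsf{some}\ y))$ and $(\mathsf{all}\ y\ (r\ \mathsf{some}\ x))$ infer $(\mathsf{all}\ (s\ \mathsf{all}\ x)\ (s\ \mathsf{some}\ x))$; first cases rule: given a derivation of $\varphi$ from $\Gamma\cup\{(\mathsf{all}\ (r\ \mathsf{all}\ x)\ (r\ \mathsf{some}\ x))\}$ and a derivation of $\varphi$ from $\Gamma\cup\{(\mathsf{all}\ y\ (s\ \mathsf{all}\ x))\}$, conclude $\varphi$ from $\Gamma$; second cases rule: given a derivation of $\varphi$ from $\Gamma\cup\{(\mathsf{all}\ (r\ \mathsf{all}\ x)\ (r\ \mathsf{some}\ x))\}$ and a derivation of $\varphi$ from $\Gamma\cup\{(\mathsf{all}\ x\ y)\}$, conclude $\varphi$ from $\Gamma$. (In the cases rules the displayed extra assumptions are withdrawn, zero or more occurrences.) -}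

module Defs where

open import Data.Product using (∃; _×_)
open import Level using (Level; suc)
open import Relation.Binary.Core using (Rel)
open import Relation.Unary using (Pred; _∈_; _⊆_; _∪_; ｛_｝)

private
  variable
    ℓ : Level
    P R : Set ℓ

infix 30 _all_ _some_

data Term (P R : Set ℓ) : Set ℓ where
  noun   : P → Term P R
  _all_  : R → Term P R → Term P R
  _some_ : R → Term P R → Term P R

data Sentence (P R : Set ℓ) : Set ℓ where
  All : Term P R → Term P R → Sentence P R

Theory : (P R : Set ℓ) → Set (suc ℓ)
Theory {ℓ} P R = Pred (Sentence P R) ℓ

-- The carrier may be empty.
record Model (P R : Set ℓ) : Set (suc ℓ) where
  field
    Carrier : Set ℓ
    nounᴹ   : P → Pred Carrier ℓ
    verbᴹ   : R → Rel Carrier ℓ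

  ⟦_⟧ : Term P R → Pred Carrier ℓ
  ⟦ noun p ⟧   = nounᴹ p
  ⟦ r all x ⟧  m = ∀ n → n ∈ ⟦ x ⟧ → verbᴹ r m n
  ⟦ r some x ⟧ m = ∃ λ n → n ∈ ⟦ x ⟧ × verbᴹ r m n

infix 4 _⊩_ _⊨_ _⊢_

_⊩_ : Model P R → Sentence P R → Set _
M ⊩ All x y = ⟦ x ⟧ ⊆ ⟦ y ⟧
  where open Model M

-- Models range over the same universe as P and R.
_⊨_ : Theory P R → Sentence P R → Set _
_⊨_ {P = P} {R = R} Γ φ =
  (M : Model P R) → (∀ ψ → ψ ∈ Γ → M ⊩ ψ) → M ⊩ φ

-- Natural deduction in sequent form: an element of Γ ⊢ φ is a derivation of φ
-- whose open assumptions lie in Γ.  The two cases rules withdraw the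
-- assumption adjoined to Γ, which may have been used any number of times
-- (including zero).
data _⊢_ {P R : Set ℓ} (Γ : Theory P R) : Sentence P R → Set ℓ where
  assume : ∀ {φ} → φ ∈ Γ → Γ ⊢ φ
  axiom  : ∀ {x} → Γ ⊢ All x x
  barbara : ∀ {x y z} → Γ ⊢ All x y → Γ ⊢ All y z → Γ ⊢ All x z
  anti   : ∀ {x y} {r : R} → Γ ⊢ All x y → Γ ⊢ All (r all y) (r all x)
  mono   : ∀ {x y} {r : R} → Γ ⊢ All x y → Γ ⊢ All (r some x) (r some y)
  nonempty : ∀ {x y} {r s : R} →
    Γ ⊢ All (r all y) (r some y) →
    Γ ⊢ All y (r some x) →
    Γ ⊢ All (s all x) (s some x)
  cases₁ : ∀ {x y φ} {r s : R} →
    (Γ ∪ ｛ All (r all x) (r some x) ｝) ⊢ φ →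
    (Γ ∪ ｛ All y (s all x) ｝) ⊢ φ →
    Γ ⊢ φ
  cases₂ : ∀ {x y φ} {r : R} →
    (Γ ∪ ｛ All (r all x) (r some x) ｝) ⊢ φ →
    (Γ ∪ ｛ All x y ｝) ⊢ φ →
    Γ ⊢ φ

{-# OPTIONS --safe #-}
module Submission where

-- Soundness is an induction on derivations; excluded middle decides whether
-- the relevant term denotes the empty set.
--
-- Completeness is a Henkin argument.  If Γ does not prove All u v, extend Γ to
-- a theory Δ that does not prove All u v either, but does so once any
-- unprovable sentence is adjoined (lindenbaum).  Call x inhabited in Δ when Δ
-- proves All (r all x) (r some x) for every verb r; in a nonempty model this
-- sentence says that x is nonempty.  If one of these sentences is unprovable,
-- adjoining it to Δ yields All u v.  By the cases rules, adjoining a sentence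
-- All y (s all x) or All x y then cannot yield All u v, so Δ proves all of
-- them.  Hence a term that is not inhabited behaves provably like the empty
-- set (inhabited-or-void).
--
-- The canonical model has two points for each inhabited term x, both lying in
-- exactly those y for which Δ proves All x y (the truth lemma, ∈⇒⊢ and ⊢⇒∈).
-- One copy of y receives an r-arrow from the points of x when Δ proves
-- All x (r all y), and the other when Δ proves All x (r some y).  The second
-- copy supplies witnesses for r some y.  The first ensures that a point of x
-- has arrows to everything in y only if Δ proves All x (r all y).
--
-- The nouns and verbs may be uncountable, so Δ comes from a Zorn argument.
-- The excluded middle used here applies to all types, not only to those with
-- at most one element, and therefore acts as a choice operator.  It also lets
-- subsets be coded by truth values, which keeps power sets in the same
-- universe.  The maximal subset is the union of a transfinite tower, whose
-- linearity is proved by a double induction (tower-linear).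

open import Defs
open import Axiom.ExcludedMiddle using (ExcludedMiddle)
open import Axiom.Extensionality.Propositional using (Extensionality)
open import Data.Bool.Base using (Bool; true; false)
open import Data.Empty using (⊥-elim)
open import Data.Product using (Σ; ∃; _×_; _,_; proj₁)
open import Data.Sum using (_⊎_; inj₁; inj₂)
open import Function.Base using (_∘_)
open import Function.Bundles using (_⇔_; mk⇔)
open import Level using (Level; Lift; lift)
open import Relation.Binary.PropositionalEquality using (_≡_; refl; sym; subst)
open import Relation.Nullary using (¬_; Dec; yes; no; does)
open import Relation.Nullary.Decidable using (decidable-stable)
open import Relation.Unary using (Pred; _⊆_; _⊆′_; _∪_; ｛_｝)

private
  variable
    ℓ : Level

-- Subsets coded by truth values

-- Characteristic functions of subsets.  Truth values are lifted so that
-- membership is a predicate at the level of A.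
𝒫 : Set ℓ → Set ℓ
𝒫 {ℓ} A = A → Lift ℓ Bool

Mem : {A : Set ℓ} → 𝒫 A → Pred A ℓ
Mem S a = S a ≡ lift true

-- Linearly ordered by inclusion; the empty family counts as a chain.
Chain : {A : Set ℓ} → 𝒫 (𝒫 A) → Set ℓ
Chain F = ∀ S S′ → Mem F S → Mem F S′ → Mem S ⊆ Mem S′ ⊎ Mem S′ ⊆ Mem S

module Subsets {ℓ} (em : ExcludedMiddle ℓ) where

  -- The code of a predicate.
  ⌊_⌋ : {A : Set ℓ} → Pred A ℓ → 𝒫 A
  ⌊ Q ⌋ a = lift (does (em {Q a}))

  code : {A : Set ℓ} (Q : Pred A ℓ) → Q ⊆ Mem ⌊ Q ⌋
  code Q {a} q with em {Q a}
  ... | yes _ = refl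
  ... | no ¬q = ⊥-elim (¬q q)

  decode : {A : Set ℓ} (Q : Pred A ℓ) → Mem ⌊ Q ⌋ ⊆ Q
  decode Q {a} m with em {Q a} | m
  ... | yes q | _  = q
  ... | no _  | ()

  Covered : {A : Set ℓ} → 𝒫 (𝒫 A) → Pred A ℓ
  Covered F a = ∃ λ S → Mem F S × Mem S a

  ⋃ : {A : Set ℓ} → 𝒫 (𝒫 A) → 𝒫 A
  ⋃ F = ⌊ Covered F ⌋

  ⋃-upper : {A : Set ℓ} (F : 𝒫 (𝒫 A)) {S : 𝒫 A} → Mem F S → Mem S ⊆ Mem (⋃ F)
  ⋃-upper F S∈F a∈S = code (Covered F) (_ , S∈F , a∈S)

  ⋃-least : {A : Set ℓ} (F : 𝒫 (𝒫 A)) {Q : Pred A ℓ} →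
    (∀ S → Mem F S → Mem S ⊆ Q) → Mem (⋃ F) ⊆ Q
  ⋃-least F below a∈⋃ with decode (Covered F) a∈⋃
  ... | S , S∈F , a∈S = below S S∈F a∈S

  adjoin : {A : Set ℓ} → 𝒫 A → A → 𝒫 A
  adjoin S a = ⌊ Mem S ∪ ｛ a ｝ ⌋

-- Maximal subsets

-- A form of Zorn's lemma: a property of subsets that is preserved by unions of
-- chains holds of a subset to which no new element can be adjoined.
module Zorn {ℓ} (em : ExcludedMiddle ℓ) (ext : Extensionality ℓ ℓ) {A : Set ℓ}
  (Good : Pred (𝒫 A) ℓ)
  (⋃-good : ∀ F → Chain F → (∀ S → Mem F S → Good S) → Good (Subsets.⋃ em F))
  where

  open Subsets em

  ⊆-antisym : {S S′ : 𝒫 A} → Mem S ⊆ Mem S′ → Mem S′ ⊆ Mem S → S ≡ S′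
  ⊆-antisym {S} {S′} sub sup = ext λ a → same (S a) (S′ a) sub sup
    where
    same : (b c : Lift ℓ Bool) → (b ≡ lift true → c ≡ lift true) →
      (c ≡ lift true → b ≡ lift true) → b ≡ c
    same (lift true)  _            f _ = sym (f refl)
    same (lift false) (lift true)  _ g = g refl
    same (lift false) (lift false) _ _ = refl

  -- The elements whose adjunction is a proper extension preserving Good.
  Extender : 𝒫 A → Pred A ℓ
  Extender S a = ¬ Mem S a × Good (adjoin S a)

  extend : (S : 𝒫 A) → Dec (∃ (Extender S)) → 𝒫 A
  extend S (yes (a , _)) = adjoin S a
  extend S (no _)        = S

  -- The witness carried by the decision is the chosen new element.
  next : 𝒫 A → 𝒫 A
  next S = extend S em

  next-inflationary : (S : 𝒫 A) → Mem S ⊆ Mem (next S)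
  next-inflationary S with em {∃ (Extender S)}
  ... | yes (a , _) = code (Mem S ∪ ｛ a ｝) ∘ inj₁
  ... | no _  = λ a∈S → a∈S

  next-good : (S : 𝒫 A) → Good S → Good (next S)
  next-good S good with em {∃ (Extender S)}
  ... | yes (_ , _ , good′) = good′
  ... | no _                = good

  next-fixed : (S : 𝒫 A) → Mem (next S) ⊆ Mem S → ¬ ∃ (Extender S)
  next-fixed S sub with em {∃ (Extender S)}
  ... | yes (a , a∉S , _) =
    λ _ → a∉S (sub (code (Mem S ∪ ｛ a ｝) (inj₂ refl)))
  ... | no none           = none

  -- The stages of the transfinite iteration of next, starting from the union
  -- of the empty family.
  data Tower : 𝒫 A → Set ℓ where
    step  : ∀ {S} → Tower S → Tower (next S)
    limit : (F : 𝒫 (𝒫 A)) → (∀ S → Mem F S → Tower S) → Tower (⋃ F)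

  -- A comparison principle for limit stages, used on both sides of the double
  -- induction below.
  ⋃-compare : (F : 𝒫 (𝒫 A)) {Y Z : 𝒫 A} →
    (∀ S → Mem F S → Mem S ⊆ Mem Y ⊎ Mem Z ⊆ Mem S) →
    Mem (⋃ F) ⊆ Mem Y ⊎ Mem Z ⊆ Mem (⋃ F)
  ⋃-compare F {Y} {Z} compare
    with em {∃ λ S → Mem F S × Mem Z ⊆ Mem S}
  ... | yes (S , S∈F , Z⊆S) = inj₂ (⋃-upper F S∈F ∘ Z⊆S)
  ... | no none = inj₁ (⋃-least F below)
    where
    below : ∀ S → Mem F S → Mem S ⊆ Mem Y
    below S S∈F with compare S S∈F
    ... | inj₁ S⊆Y = S⊆Y
    ... | inj₂ Z⊆S = ⊥-elim (none (S , S∈F , Z⊆S))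

  -- By induction on the first stage; a successor stage next X needs a second
  -- induction, no-gap, over the other stage.
  tower-linear : {X Y : 𝒫 A} → Tower X → Tower Y →
    Mem X ⊆ Mem Y ⊎ Mem (next Y) ⊆ Mem X
  tower-linear (limit F towers) tY =
    ⋃-compare F λ S S∈F → tower-linear (towers S S∈F) tY
  tower-linear {Y = Y} (step {X} tX) tY with no-gap tY
    where
    -- No stage lies strictly between X and next X.
    no-gap : {Z : 𝒫 A} → Tower Z → Mem Z ⊆ Mem X ⊎ Mem (next X) ⊆ Mem Z
    no-gap (limit F towers) = ⋃-compare F λ S S∈F → no-gap (towers S S∈F)
    no-gap (step {Z} tZ) with no-gap tZ | tower-linear tX tZ
    ... | inj₂ next⊆Z | _          = inj₂ (next-inflationary Z ∘ next⊆Z)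
    ... | inj₁ _      | inj₂ nZ⊆X  = inj₁ nZ⊆X
    ... | inj₁ Z⊆X    | inj₁ X⊆Z   =
      inj₂ (λ {a} → subst (λ W → Mem (next W) a) (⊆-antisym X⊆Z Z⊆X))
  ... | inj₂ next⊆Y = inj₁ next⊆Y
  ... | inj₁ Y⊆X with tower-linear tX tY
  ...   | inj₂ nY⊆X = inj₂ (next-inflationary X ∘ nY⊆X)
  ...   | inj₁ X⊆Y  =
    inj₂ (λ {a} → subst (λ W → Mem (next W) a) (⊆-antisym Y⊆X X⊆Y))

  tower-chain : (F : 𝒫 (𝒫 A)) → (∀ S → Mem F S → Tower S) → Chain F
  tower-chain F towers S S′ S∈F S′∈F
    with tower-linear (towers S S∈F) (towers S′ S′∈F)
  ... | inj₁ S⊆S′  = inj₁ S⊆S′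
  ... | inj₂ nS′⊆S = inj₂ (nS′⊆S ∘ next-inflationary S′)

  tower-good : {S : 𝒫 A} → Tower S → Good S
  tower-good (step {S} t) = next-good S (tower-good t)
  tower-good (limit F towers) =
    ⋃-good F (tower-chain F towers) λ S S∈F → tower-good (towers S S∈F)

  -- The union of all stages is itself a stage, hence a fixed point of next.
  zorn : ∃ λ S → Good S × (∀ a → Good (adjoin S a) → Mem S a)
  zorn = top , tower-good top-tower , λ a good →
    decidable-stable em λ a∉top →
      next-fixed top (⋃-upper ⌊ Tower ⌋ (code Tower (step top-tower)))
        (a , a∉top , good)
    where
    top : 𝒫 A
    top = ⋃ ⌊ Tower ⌋

    top-tower : Tower top
    top-tower = limit ⌊ Tower ⌋ λ S → decode Tower

-- Derivations

module _ {P R : Set ℓ} where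

  ∪-monoˡ : {Γ Δ Θ : Theory P R} → Γ ⊆′ Δ → Γ ∪ Θ ⊆′ Δ ∪ Θ
  ∪-monoˡ sub ψ (inj₁ ψ∈Γ) = inj₁ (sub ψ ψ∈Γ)
  ∪-monoˡ sub ψ (inj₂ ψ∈Θ) = inj₂ ψ∈Θ

  ∪-monoʳ : {Γ Δ Θ : Theory P R} → Γ ⊆′ Δ → Θ ∪ Γ ⊆′ Θ ∪ Δ
  ∪-monoʳ sub ψ (inj₁ ψ∈Θ) = inj₁ ψ∈Θ
  ∪-monoʳ sub ψ (inj₂ ψ∈Γ) = inj₂ (sub ψ ψ∈Γ)

  ∪-swap : {Γ Δ Θ : Theory P R} → (Γ ∪ Δ) ∪ Θ ⊆′ (Γ ∪ Θ) ∪ Δ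
  ∪-swap ψ (inj₁ (inj₁ ψ∈Γ)) = inj₁ (inj₁ ψ∈Γ)
  ∪-swap ψ (inj₁ (inj₂ ψ∈Δ)) = inj₂ ψ∈Δ
  ∪-swap ψ (inj₂ ψ∈Θ)        = inj₁ (inj₂ ψ∈Θ)

  ∪-under : {Γ Δ Θ Λ : Theory P R} → Γ ⊆′ Δ ∪ Θ → Γ ∪ Λ ⊆′ (Δ ∪ Λ) ∪ Θ
  ∪-under sub ψ (inj₂ ψ∈Λ) = inj₁ (inj₂ ψ∈Λ)
  ∪-under sub ψ (inj₁ ψ∈Γ) with sub ψ ψ∈Γ
  ... | inj₁ ψ∈Δ = inj₁ (inj₁ ψ∈Δ)
  ... | inj₂ ψ∈Θ = inj₂ ψ∈Θ

  weaken : {Γ Δ : Theory P R} {φ : Sentence P R} → Γ ⊆′ Δ → Γ ⊢ φ → Δ ⊢ φ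
  weaken sub (assume φ∈Γ)   = assume (sub _ φ∈Γ)
  weaken sub axiom          = axiom
  weaken sub (barbara d e)  = barbara (weaken sub d) (weaken sub e)
  weaken sub (anti d)       = anti (weaken sub d)
  weaken sub (mono d)       = mono (weaken sub d)
  weaken sub (nonempty d e) = nonempty (weaken sub d) (weaken sub e)
  weaken sub (cases₁ d e)   =
    cases₁ (weaken (∪-monoˡ sub) d) (weaken (∪-monoˡ sub) e)
  weaken sub (cases₂ d e)   =
    cases₂ (weaken (∪-monoˡ sub) d) (weaken (∪-monoˡ sub) e)

module Compactness {ℓ} (em : ExcludedMiddle ℓ) {P R : Set ℓ} where

  open Subsets em

  module _ (F : 𝒫 (𝒫 (Sentence P R))) (chain : Chain F) where

    private
      -- Derivability from Θ together with one member of F.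
      From : Theory P R → Pred (Sentence P R) ℓ
      From Θ ψ = ∃ λ S → Mem F S × (Θ ∪ Mem S) ⊢ ψ

      map-from : ∀ {Θ ψ χ} →
        (∀ {Δ} → Δ ⊢ ψ → Δ ⊢ χ) → From Θ ψ → From Θ χ
      map-from rule (S , S∈F , d) = S , S∈F , rule d

      -- Two derivations can be taken from the larger of the two members.
      zip-from : ∀ {Θ₁ Θ₂ Θ ψ₁ ψ₂ χ} →
        (∀ {S} → (Θ₁ ∪ Mem S) ⊢ ψ₁ → (Θ₂ ∪ Mem S) ⊢ ψ₂ → (Θ ∪ Mem S) ⊢ χ) →
        From Θ₁ ψ₁ → From Θ₂ ψ₂ → From Θ χ
      zip-from rule (S , S∈F , d) (S′ , S′∈F , e) with chain S S′ S∈F S′∈F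
      ... | inj₁ S⊆S′ = S′ , S′∈F , rule (weaken (∪-monoʳ λ _ → S⊆S′) d) e
      ... | inj₂ S′⊆S = S , S∈F , rule d (weaken (∪-monoʳ λ _ → S′⊆S) e)

    -- The theory Θ collects the assumptions adjoined by the cases rules; the
    -- inclusion hypothesis makes the induction go through under them.
    compactness : ∃ (Mem F) → ∀ {Θ Δ ψ} →
      Δ ⊆′ Θ ∪ Mem (⋃ F) → Δ ⊢ ψ → ∃ λ S → Mem F S × (Θ ∪ Mem S) ⊢ ψ
    compactness (S₀ , S₀∈F) = go
      where
      go : ∀ {Θ Δ ψ} → Δ ⊆′ Θ ∪ Mem (⋃ F) → Δ ⊢ ψ → From Θ ψ

      under : ∀ {Θ Δ χ ψ} → Δ ⊆′ Θ ∪ Mem (⋃ F) → (Δ ∪ ｛ χ ｝) ⊢ ψ →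
        From (Θ ∪ ｛ χ ｝) ψ
      under sub = go (∪-under sub)

      go sub (assume ψ∈Δ) with sub _ ψ∈Δ
      ... | inj₁ ψ∈Θ = S₀ , S₀∈F , assume (inj₁ ψ∈Θ)
      ... | inj₂ ψ∈⋃ with decode (Covered F) ψ∈⋃
      ...   | S , S∈F , ψ∈S = S , S∈F , assume (inj₂ ψ∈S)
      go sub axiom          = S₀ , S₀∈F , axiom
      go sub (barbara d e)  = zip-from barbara (go sub d) (go sub e)
      go sub (anti d)       = map-from anti (go sub d)
      go sub (mono d)       = map-from mono (go sub d)
      go sub (nonempty d e) = zip-from nonempty (go sub d) (go sub e)
      go sub (cases₁ d e)   =
        zip-from (λ d′ e′ → cases₁ (weaken ∪-swap d′) (weaken ∪-swap e′))
          (under sub d) (under sub e)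
      go sub (cases₂ d e)   =
        zip-from (λ d′ e′ → cases₂ (weaken ∪-swap d′) (weaken ∪-swap e′))
          (under sub d) (under sub e)

-- Maximal theories

-- The theory Δ does not prove φ, but adjoining any sentence that Δ does not
-- prove makes φ provable.
record MaximalAvoiding {P R : Set ℓ} (φ : Sentence P R) (Δ : Theory P R) : Set ℓ where
  field
    avoids  : ¬ (Δ ⊢ φ)
    maximal : ∀ ψ → ¬ (Δ ⊢ ψ) → (Δ ∪ ｛ ψ ｝) ⊢ φ

lindenbaum : ExcludedMiddle ℓ → Extensionality ℓ ℓ →
  {P R : Set ℓ} {Γ : Theory P R} {φ : Sentence P R} → ¬ (Γ ⊢ φ) →
  ∃ λ Δ → Γ ⊆′ Δ × MaximalAvoiding φ Δ
lindenbaum {ℓ} em ext {P} {R} {Γ} {φ} Γ⊬φ with Zorn.zorn em ext Good ⋃-good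
  where
  open Subsets em
  open Compactness em

  Good : Pred (𝒫 (Sentence P R)) ℓ
  Good S = ¬ ((Γ ∪ Mem S) ⊢ φ)

  ⋃-good : ∀ F → Chain F → (∀ S → Mem F S → Good S) → Good (⋃ F)
  ⋃-good F chain good d with em {∃ (Mem F)}
  ... | no empty = Γ⊬φ (weaken nothing-new d)
    where
    nothing-new : Γ ∪ Mem (⋃ F) ⊆′ Γ
    nothing-new ψ (inj₁ ψ∈Γ) = ψ∈Γ
    nothing-new ψ (inj₂ ψ∈⋃) =
      ⋃-least F {Γ} (λ S S∈F → ⊥-elim (empty (S , S∈F))) ψ∈⋃
  ... | yes inhabited with compactness F chain inhabited (λ _ ψ∈ → ψ∈) d
  ...   | S , S∈F , e = good S S∈F e
... | S , good , maximal-S = Γ ∪ Mem S , (λ _ → inj₁) , record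
  { avoids  = good
  ; maximal = λ ψ Δ⊬ψ → decidable-stable em λ ⊬φ →
      Δ⊬ψ (assume (inj₂ (maximal-S ψ λ d → ⊬φ (weaken split d))))
  }
  where
  split : ∀ {ψ} → Γ ∪ Mem (Subsets.adjoin em S ψ) ⊆′ (Γ ∪ Mem S) ∪ ｛ ψ ｝
  split χ (inj₁ χ∈Γ) = inj₁ (inj₁ χ∈Γ)
  split {ψ} χ (inj₂ χ∈) with Subsets.decode em (Mem S ∪ ｛ ψ ｝) χ∈
  ... | inj₁ χ∈S = inj₁ (inj₂ χ∈S)
  ... | inj₂ ψ≡χ = inj₂ ψ≡χ

-- The canonical model

module Canonical {ℓ} (em : ExcludedMiddle ℓ) {P R : Set ℓ}
  {φ : Sentence P R} {Δ : Theory P R} (max : MaximalAvoiding φ Δ) where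

  open MaximalAvoiding max

  infix 4 _≤_

  _≤_ : Term P R → Term P R → Set ℓ
  x ≤ y = Δ ⊢ All x y

  -- For each verb, Δ proves the sentence expressing that x is nonempty (in a
  -- nonempty model).
  Inhabited : Pred (Term P R) ℓ
  Inhabited x = ∀ (r : R) → r all x ≤ r some x

  -- In Δ, the term x is provably like the empty set.
  Void : Pred (Term P R) ℓ
  Void x = (∀ y (s : R) → y ≤ s all x) × (∀ y → x ≤ y)

  inhabited-or-void : ∀ x → Inhabited x ⊎ Void x
  inhabited-or-void x with em {∃ λ (r : R) → ¬ (r all x ≤ r some x)}
  ... | no none = inj₁ λ r → decidable-stable em λ ¬p → none (r , ¬p)
  ... | yes (r , ¬p) = inj₂
    ( (λ y s → decidable-stable em λ ¬q →
        avoids (cases₁ (maximal _ ¬p) (maximal _ ¬q)))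
    , (λ y → decidable-stable em λ ¬q →
        avoids (cases₂ (maximal _ ¬p) (maximal _ ¬q))) )

  -- The first copy of a term is marked false and the second true.
  Point : Set ℓ
  Point = Σ (Term P R) Inhabited × Bool

  Arrow : R → Point → Point → Set ℓ
  Arrow r ((x , _) , _) ((y , _) , false) = x ≤ r all y
  Arrow r ((x , _) , _) ((y , _) , true)  = x ≤ r some y

  canonical : Model P R
  canonical = record
    { Carrier = Point
    ; nounᴹ   = λ p → λ { ((x , _) , _) → x ≤ noun p }
    ; verbᴹ   = Arrow
    }

  open Model canonical using (⟦_⟧)

  arrow-from-all : ∀ {r} m n →
    proj₁ (proj₁ m) ≤ r all proj₁ (proj₁ n) → Arrow r m n
  arrow-from-all m (_        , false) d = d
  arrow-from-all m ((_ , ne) , true)  d = barbara d (ne _)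

  some-from-arrow : ∀ {r} m n →
    Arrow r m n → proj₁ (proj₁ m) ≤ r some proj₁ (proj₁ n)
  some-from-arrow m ((_ , ne) , false) d = barbara d (ne _)
  some-from-arrow m (_        , true)  d = d

  mutual

    ∈⇒⊢ : ∀ t m → ⟦ t ⟧ m → proj₁ (proj₁ m) ≤ t
    ∈⇒⊢ (noun p) m m∈ = m∈
    ∈⇒⊢ (r all y) m m∈ with inhabited-or-void y
    ... | inj₁ ne         = m∈ ((y , ne) , false) (⊢⇒∈ y _ axiom)
    ... | inj₂ (full , _) = full _ r
    ∈⇒⊢ (r some y) m (n , n∈y , arrow) =
      barbara (some-from-arrow m n arrow) (mono (∈⇒⊢ y n n∈y))

    ⊢⇒∈ : ∀ t m → proj₁ (proj₁ m) ≤ t → ⟦ t ⟧ m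
    ⊢⇒∈ (noun p) m d = d
    ⊢⇒∈ (r all y) m d n n∈y =
      arrow-from-all m n (barbara d (anti (∈⇒⊢ y n n∈y)))
    -- The term y is inhabited because x is and x ≤ r some y.
    ⊢⇒∈ (r some y) ((x , ne) , i) d =
      ((y , λ s → nonempty (ne r) d) , true) , ⊢⇒∈ y _ axiom , d

  canonical-⊩ : ∀ ψ → Δ ψ → canonical ⊩ ψ
  canonical-⊩ (All x y) ψ∈Δ {m} m∈x =
    ⊢⇒∈ y m (barbara (∈⇒⊢ x m m∈x) (assume ψ∈Δ))

  -- A sentence All u v with u void would be provable, so the term u has a
  -- point, and that point refutes All u v.
  canonical-⊮ : ¬ (canonical ⊩ φ)
  canonical-⊮ = refute φ avoids
    where
    refute : ∀ ψ → ¬ (Δ ⊢ ψ) → ¬ (canonical ⊩ ψ)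
    refute (All u v) Δ⊬ψ ⊩ψ with inhabited-or-void u
    ... | inj₂ (_ , least) = Δ⊬ψ (least v)
    ... | inj₁ ne = Δ⊬ψ (∈⇒⊢ v point (⊩ψ {point} (⊢⇒∈ u point axiom)))
      where
      point : Point
      point = (u , ne) , false

-- Soundness and completeness

module Soundness {ℓ} (em : ExcludedMiddle ℓ) {P R : Set ℓ} (M : Model P R) where

  open Model M

  Satisfies : Theory P R → Set ℓ
  Satisfies Γ = ∀ ψ → Γ ψ → M ⊩ ψ

  adjoin-sat : ∀ {Γ} ψ → Satisfies Γ → M ⊩ ψ → Satisfies (Γ ∪ ｛ ψ ｝)
  adjoin-sat ψ sat ⊩ψ χ (inj₁ χ∈Γ)  = sat χ χ∈Γ
  adjoin-sat ψ sat ⊩ψ _ (inj₂ refl) = ⊩ψ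

  witness-⊩ : ∀ {x} (r : R) → ∃ ⟦ x ⟧ → M ⊩ All (r all x) (r some x)
  witness-⊩ r (n , n∈x) m∈ = n , n∈x , m∈ n n∈x

  -- If y were empty, then r all y would be everything and r some y nothing,
  -- which is impossible as soon as the model has a point.
  nonempty-⊩ : ∀ {y} (r : R) → M ⊩ All (r all y) (r some y) →
    Carrier → ∃ ⟦ y ⟧
  nonempty-⊩ {y} r sub m = decidable-stable em λ empty →
    let (n , n∈y , _) = sub {m} (λ n n∈y → ⊥-elim (empty (n , n∈y)))
    in empty (n , n∈y)

  sound : ∀ {Γ φ} → Satisfies Γ → Γ ⊢ φ → M ⊩ φ
  sound sat (assume φ∈Γ) = sat _ φ∈Γ
  sound sat axiom = λ m∈x → m∈x
  sound sat (barbara d e) = λ m∈x → sound sat e (sound sat d m∈x)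
  sound sat (anti d) = λ m∈ n n∈x → m∈ n (sound sat d n∈x)
  sound sat (mono d) = λ (n , n∈x , arrow) → n , sound sat d n∈x , arrow
  sound sat (nonempty {y = y} {r = r} d e) {m} m∈
    with nonempty-⊩ {y} r (λ {k} → sound sat d {k}) m
  ... | n , n∈y with sound sat e n∈y
  ...   | k , k∈x , _ = k , k∈x , m∈ k k∈x
  sound sat (cases₁ {x} {y} {r = r} {s = s} d e) with em {∃ ⟦ x ⟧}
  ... | yes inh  = sound (adjoin-sat (All (r all x) (r some x)) sat
    λ {m} → witness-⊩ {x} r inh {m}) d
  ... | no empty =
    sound (adjoin-sat (All y (s all x)) sat λ _ n n∈x → ⊥-elim (empty (n , n∈x))) e
  sound sat (cases₂ {x} {y} {r = r} d e) with em {∃ ⟦ x ⟧}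
  ... | yes inh  = sound (adjoin-sat (All (r all x) (r some x)) sat
    λ {m} → witness-⊩ {x} r inh {m}) d
  ... | no empty =
    sound (adjoin-sat (All x y) sat λ n∈x → ⊥-elim (empty (_ , n∈x))) e

complete : ExcludedMiddle ℓ → Extensionality ℓ ℓ →
  {P R : Set ℓ} {Γ : Theory P R} {φ : Sentence P R} → Γ ⊨ φ → Γ ⊢ φ
complete em ext {Γ = Γ} {φ} Γ⊨φ = decidable-stable em λ Γ⊬φ →
  let (Δ , Γ⊆Δ , max) = lindenbaum em ext Γ⊬φ
      open Canonical em max
  in canonical-⊮ (Γ⊨φ canonical λ ψ ψ∈Γ → canonical-⊩ ψ (Γ⊆Δ ψ ψ∈Γ))

theorem3p9 : ∀ {ℓ} → ExcludedMiddle ℓ → Extensionality ℓ ℓ →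
    (P R : Set ℓ) (Γ : Theory P R) (φ : Sentence P R) →
    (Γ ⊨ φ) ⇔ (Γ ⊢ φ)
theorem3p9 em ext P R Γ φ =
  mk⇔ (complete em ext) (λ d M sat → Soundness.sound em M sat d)
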